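{- If $f:\{0,1\}^n\times\{0,1\}^n\to\{0,1\}$ is computed by a deterministic branching program of size $s$, then $\mathrm{bitpdim}(f)\le 6s$.
   Context: Deterministic branching program: a directed acyclic graph with distinct start, accept and reject nodes; accept and reject have out-degree $0$; every other vertex is labelled by an input variable and has two outgoing edges, labelled $0$ and $1$. On an input, an edge labelled $b$ leaving a vertex labelled $z$ is closed if $z=b$. The program accepts iff there is a path of closed edges from start to accept; it computes $f$ if it accepts exactly the inputs with $f=1$. Its size is the number of vertices (including accept and reject). Bitwise decomposable projective dimension: for $f:\{0,1\}^n\times\{0,1\}^n\to\{0,1\}$, $\mathrm{bitpdim}(f)\le d$ if there are subspaces of $\mathbb{F}_2^d$, $\mathcal{C}=\{U_i^a\}_{i\in[n],a\in\{0,1\}}$ and $\mathcal{D}=\{V_j^b\}_{j\in[n],b\in\{0,1\}}$, such that: (1) with $\phi(x)=\mathrm{span}_{1\le i\le n}U_i^{x_i}$ for $x\in\{0,1\}^n$ on the left side and $\phi(y)=\mathrm{span}_{1\le j\le n}V_j^{y_j}$ for $y\in\{0,1\}^n$ on the right side, for all $(x,y)$: $f(x,y)=1$ iff $\phi(x)\cap\phi(y)\neq\{0\}$; (2) each $W\in\mathcal{C}\cup\mathcal{D}$ equals $\mathrm{span}(S')$ for some $S'\subseteq S=\{e_i-e_j: i,j\in[d], i\ne j\}$, where $e_i$ are the standard basis vectors; (3) for all disjoint $S_1,S_2\subseteq[n]\times\{0,1\}$, $\mathrm{span}_{(i,a)\in S_1}U_i^a\cap\mathrm{span}_{(j,b)\in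 S_2}U_j^b=\{0\}$, and likewise for the subspaces $V_j^b$ in $\mathcal{D}$. $\mathrm{bitpdim}(f)$ is the least such $d$. -}

module Defs where

open import Data.Bool using (Bool; true; false; _xor_)
open import Data.Fin using (Fin)
open import Data.Nat using (ℕ)
open import Data.Product using (∃; ∃-syntax; Σ-syntax; ∃₂; _×_; _,_; proj₁)
open import Data.Sum using (_⊎_; [_,_]′)
open import Data.Vec using (Vec; lookup; replicate; zipWith; _[_]≔_)
open import Function using (_⇔_; _∘_)
open import Level using (0ℓ)
open import Relation.Binary.Construct.Closure.ReflexiveTransitive using (Star)
open import Relation.Binary.Construct.Closure.Transitive using (TransClosure)
open import Relation.Binary.PropositionalEquality using (_≡_; _≢_)
open import Relation.Nullary using (¬_)
open import Relation.Unary using (Pred; _∈_; _∩_; _⊆_; _⊥_; _≐_; ｛_｝; ⋃)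

private
  variable
    d n s : ℕ
    Var   : Set

------------------------------------------------------------------------
-- Deterministic branching programs

data Node (Var : Set) (s : ℕ) : Set where
  sink  : Node Var s
  -- query z next: label z, with the edge labelled b leading to next b
  query : (z : Var) (next : Bool → Fin s) → Node Var s

-- Programs of size s: the vertices, including accept and reject, are Fin s.
record BranchingProgram (Var : Set) (s : ℕ) : Set where
  field
    node                 : Fin s → Node Var s
    start accept reject  : Fin s
    start≢accept         : start ≢ accept
    start≢reject         : start ≢ reject
    accept≢reject        : accept ≢ reject
    sink⇔                : ∀ v → node v ≡ sink ⇔ (v ≡ accept ⊎ v ≡ reject)

  -- Edge u z b w: u is labelled z and its outgoing edge labelled b ends in w.
  Edge : Fin s → Var → Bool → Fin s → Set
  Edge u z b w = ∃[ next ] (node u ≡ query z next × next b ≡ w)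

  _⟶_ : Fin s → Fin s → Set
  u ⟶ w = ∃₂ λ z b → Edge u z b w

  field
    acyclic : ∀ v → ¬ TransClosure _⟶_ v v

  Closed : (Var → Bool) → Fin s → Fin s → Set
  Closed σ u w = ∃₂ λ z b → Edge u z b w × σ z ≡ b

  Accepts : (Var → Bool) → Set
  Accepts σ = Star (Closed σ) start accept

-- The input variables of f(x , y) are the bits of x (left summand) and the
-- bits of y (right summand).
Computes : BranchingProgram (Fin n ⊎ Fin n) s →
           (Vec Bool n → Vec Bool n → Bool) → Set
Computes P f = ∀ x y →
  BranchingProgram.Accepts P [ lookup x , lookup y ]′ ⇔ f x y ≡ true

------------------------------------------------------------------------
-- Linear algebra over 𝔽₂, with Bool under _xor_ and _∧_ as the field.
-- Subtraction is addition, and closure under scalar multiplication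
-- amounts to containing the zero vector.

𝔽₂^ : ℕ → Set
𝔽₂^ d = Vec Bool d

0ᵥ : 𝔽₂^ d
0ᵥ = replicate _ false

infixl 6 _+ᵥ_ _-ᵥ_

_+ᵥ_ _-ᵥ_ : 𝔽₂^ d → 𝔽₂^ d → 𝔽₂^ d
_+ᵥ_ = zipWith _xor_
_-ᵥ_ = _+ᵥ_

e : Fin d → 𝔽₂^ d
e i = 0ᵥ [ i ]≔ true

record Subspace (d : ℕ) : Set₁ where
  field
    ⟦_⟧      : Pred (𝔽₂^ d) 0ℓ
    0-closed : 0ᵥ ∈ ⟦_⟧
    +-closed : ∀ {v w} → v ∈ ⟦_⟧ → w ∈ ⟦_⟧ → v +ᵥ w ∈ ⟦_⟧

open Subspace public using (⟦_⟧)

data Span (G : Pred (𝔽₂^ d) 0ℓ) : Pred (𝔽₂^ d) 0ℓ where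
  gen  : ∀ {v} → v ∈ G → v ∈ Span G
  zero : 0ᵥ ∈ Span G
  add  : ∀ {v w} → v ∈ Span G → w ∈ Span G → v +ᵥ w ∈ Span G

span : Pred (𝔽₂^ d) 0ℓ → Subspace d
span G = record { ⟦_⟧ = Span G ; 0-closed = zero ; +-closed = add }

-- The span of a family of subspaces.
⨆ : {I : Set} → (I → Subspace d) → Subspace d
⨆ {I = I} W = span (⋃ I (⟦_⟧ ∘ W))

------------------------------------------------------------------------
-- Bitwise decomposable projective dimension

EdgeVectors : Pred (𝔽₂^ d) 0ℓ
EdgeVectors v = ∃₂ λ i j → i ≢ j × v ≡ e i -ᵥ e j

SpannedByEdgeVectors : Subspace d → Set₁
SpannedByEdgeVectors {d} W =
  Σ[ S′ ∈ Pred (𝔽₂^ d) 0ℓ ] (S′ ⊆ EdgeVectors × ⟦ W ⟧ ≐ ⟦ span S′ ⟧)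

BitFamily : ℕ → ℕ → Set₁
BitFamily n d = Fin n × Bool → Subspace d

φ : BitFamily n d → Vec Bool n → Subspace d
φ W x = ⨆ λ i → W (i , lookup x i)

-- Restriction of a family to the indices in T, as needed for ⨆.
_∣_ : BitFamily n d → (T : Pred (Fin n × Bool) 0ℓ) → ∃ T → Subspace d
(W ∣ T) k = W (proj₁ k)

DisjointSpans : BitFamily n d → Set₁
DisjointSpans {n} W = (S₁ S₂ : Pred (Fin n × Bool) 0ℓ) → S₁ ⊥ S₂ →
  ⟦ ⨆ (W ∣ S₁) ⟧ ∩ ⟦ ⨆ (W ∣ S₂) ⟧ ≐ ｛ 0ᵥ ｝

record BitwiseDecomposition (f : Vec Bool n → Vec Bool n → Bool) (d : ℕ) : Set₁ where
  field
    U V : BitFamily n d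
    -- A nonzero intersection is stated positively, by a nonzero common vector.
    represents : ∀ x y →
      f x y ≡ true ⇔ (∃[ v ] (v ∈ ⟦ φ U x ⟧ ∩ ⟦ φ V y ⟧ × v ≢ 0ᵥ))
    U-spanned  : ∀ k → SpannedByEdgeVectors (U k)
    V-spanned  : ∀ k → SpannedByEdgeVectors (V k)
    U-disjoint : DisjointSpans U
    V-disjoint : DisjointSpans V

-- bitpdim f ≤ d.  Appending unused coordinates turns a decomposition in
-- dimension d into one in any larger dimension, so a decomposition in
-- dimension exactly d exists as soon as the least dimension is at most d.
bitpdim_≤_ : (Vec Bool n → Vec Bool n → Bool) → ℕ → Set₁
bitpdim f ≤ d = BitwiseDecomposition f d

{-# OPTIONS --safe #-}
module Submission where

open import Defs
open import Data.Bool using (Bool; true; false; _∧_; _xor_; if_then_else_)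
open import Data.Bool.Properties
  using (∧-identityʳ; ∧-zeroʳ; ¬-not; xor-comm; xor-identityʳ; xor-same)
open import Data.Bool.Solver using (module xor-∧-Solver)
open import Data.Fin using (Fin; zero; suc; combine; remQuot)
open import Data.Fin.Induction using (spo-noetherian)
open import Data.Fin.Patterns using (0F; 1F; 2F; 3F; 4F; 5F)
open import Data.Fin.Properties using (_≟_; remQuot-combine; combine-remQuot)
open import Data.Maybe using (Maybe; just; nothing; map; maybe)
open import Data.Maybe.Properties using (just-injective)
open import Data.Nat using (ℕ; _*_)
open import Data.Product using (∃; ∃-syntax; ∃₂; _×_; _,_; proj₁; proj₂)
open import Data.Sum using (_⊎_; inj₁; inj₂; [_,_]′; reduce)
open import Data.Vec using (Vec; []; _∷_; lookup; tabulate)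
open import Data.Vec.Properties
  using (lookup∘update; lookup∘update′; lookup-replicate; lookup-zipWith;
         tabulate-cong; tabulate∘lookup; ∷-injective; zipWith-comm)
open import Function using (_∘_; const; flip; id; _⇔_; mk⇔; Equivalence)
open import Function.Construct.Composition using (_⇔-∘_)
open import Function.Construct.Symmetry using (⇔-sym)
open import Induction.WellFounded using (WellFounded; Acc; acc)
open import Level using (0ℓ)
open import Relation.Binary.Construct.Closure.ReflexiveTransitive using (Star; ε; _◅_)
open import Relation.Binary.Construct.Closure.Transitive using (TransClosure; [_]; _∷_; _++_)
open import Relation.Binary.PropositionalEquality
  using (_≡_; _≢_; refl; sym; trans; cong; cong₂; subst; isEquivalence; module ≡-Reasoning)
open import Relation.Binary.Structures using (IsStrictPartialOrder)
open import Relation.Nullary using (¬_; Dec; yes; no; does; contradiction)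
open import Relation.Nullary.Decidable using (does-⇔; map′; dec-true; dec-false)
open import Relation.Unary using (Pred; _∈_; _∩_; _⊆_; _⊥_; _≐_; ｛_｝)

-- Fix any index o.  Replace the edge labelled b from u to w by two parallel
-- paths u – (u , b , c) – w, c ∈ {0 , 1}.  If u reads xᵢ, the half at u goes to
-- Uᵢᵇ and the half at w to Vₒᶜ; if u reads yⱼ, the half at u goes to Vⱼᵇ and the
-- half at w to Uₒᶜ.  On input (x , y) exactly one of the paths that replace a
-- followed edge has both halves present, and none of those of any other edge has.
-- Every middle vertex is a leaf of the graph of all U-edges, and likewise for V,
-- so these edges are independent and the disjointness condition holds.  A common
-- vector of φ(x) and φ(y) has the same middle vertices in both expansions, so it
-- is a set of followed edges whose boundary vanishes once accept is identified
-- with start.  Followed edges form a forest directed towards the sinks, so such a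
-- nonempty set exists iff start runs to accept.

private
  variable
    d n s : ℕ

-- Vectors over 𝔽₂ and linear functionals

lookup-+ᵥ : (v w : 𝔽₂^ d) (i : Fin d) → lookup (v +ᵥ w) i ≡ lookup v i xor lookup w i
lookup-+ᵥ v w i = lookup-zipWith _xor_ i v w

lookup-e : (i : Fin d) → lookup (e i) i ≡ true
lookup-e i = lookup∘update i 0ᵥ true

lookup-e-≢ : {i j : Fin d} → i ≢ j → lookup (e j) i ≡ false
lookup-e-≢ {i = i} i≢j = trans (lookup∘update′ i≢j 0ᵥ true) (lookup-replicate i false)

lookup-false⇒0ᵥ : (v : 𝔽₂^ d) → (∀ i → lookup v i ≡ false) → v ≡ 0ᵥ
lookup-false⇒0ᵥ v v≗0 = begin
  v                    ≡⟨ tabulate∘lookup v ⟨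
  tabulate (lookup v)  ≡⟨ tabulate-cong (λ i → trans (v≗0 i) (sym (lookup-replicate i false))) ⟩
  tabulate (lookup 0ᵥ) ≡⟨ tabulate∘lookup 0ᵥ ⟩
  0ᵥ                   ∎
  where open ≡-Reasoning

+ᵥ-comm : (v w : 𝔽₂^ d) → v +ᵥ w ≡ w +ᵥ v
+ᵥ-comm = zipWith-comm xor-comm

+ᵥ-same : (v : 𝔽₂^ d) → v +ᵥ v ≡ 0ᵥ
+ᵥ-same []      = refl
+ᵥ-same (b ∷ v) = cong₂ _∷_ (xor-same b) (+ᵥ-same v)

-- Zero is written `a +ᵥ a` because `Trail.sum` takes this shape at `start`, where both ends of the
-- trail are the same vertex.
+ᵥ-cancel : (v w a : 𝔽₂^ d) → v +ᵥ w ≡ a +ᵥ a → v ≡ w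
+ᵥ-cancel []      []      []      _  = refl
+ᵥ-cancel (p ∷ v) (q ∷ w) (r ∷ a) eq with ∷-injective eq
... | eq₀ , eqs = cong₂ _∷_ (head p q (trans eq₀ (xor-same r))) (+ᵥ-cancel v w a eqs)
  where
  head : ∀ p q → p xor q ≡ false → p ≡ q
  head false false _ = refl
  head true  true  _ = refl

-- Serves to prepend an edge to a trail: `p` is its middle vertex, `a` and `b` its ends, `c` the end
-- of the trail. Both `p` and `b` occur twice and cancel.
+ᵥ-telescope : (p a b c v w : 𝔽₂^ d) → v +ᵥ w ≡ b +ᵥ c →
               (p +ᵥ a +ᵥ v) +ᵥ (p +ᵥ b +ᵥ w) ≡ a +ᵥ c
+ᵥ-telescope []      []      []      []      []      []      _ = refl
+ᵥ-telescope (p ∷ ps) (a ∷ as) (b ∷ bs) (c ∷ cs) (v ∷ vs) (w ∷ ws) eq with ∷-injective eq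
... | eq₀ , eqs = cong₂ _∷_ head (+ᵥ-telescope ps as bs cs vs ws eqs)
  where
  open ≡-Reasoning
  head : ((p xor a) xor v) xor ((p xor b) xor w) ≡ a xor c
  head = begin
    ((p xor a) xor v) xor ((p xor b) xor w)
      ≡⟨ solve 5 (λ p a b v w → ((p :+ a) :+ v) :+ ((p :+ b) :+ w) := (a :+ b) :+ (v :+ w))
           refl p a b v w ⟩
    (a xor b) xor (v xor w)
      ≡⟨ cong ((a xor b) xor_) eq₀ ⟩
    (a xor b) xor (b xor c)
      ≡⟨ solve 3 (λ a b c → (a :+ b) :+ (b :+ c) := a :+ c) refl a b c ⟩
    a xor c ∎
    where open xor-∧-Solver

dot : (Fin d → Bool) → 𝔽₂^ d → Bool
dot χ []      = false
dot χ (b ∷ v) = (χ zero ∧ b) xor dot (χ ∘ suc) v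

dot-0ᵥ : (χ : Fin d → Bool) → dot χ 0ᵥ ≡ false
dot-0ᵥ {ℕ.zero}  χ = refl
dot-0ᵥ {ℕ.suc d} χ rewrite ∧-zeroʳ (χ zero) = dot-0ᵥ (χ ∘ suc)

dot-+ᵥ : (χ : Fin d → Bool) (v w : 𝔽₂^ d) → dot χ (v +ᵥ w) ≡ dot χ v xor dot χ w
dot-+ᵥ χ []      []      = refl
dot-+ᵥ χ (p ∷ v) (q ∷ w) rewrite dot-+ᵥ (χ ∘ suc) v w =
  solve 5 (λ c p q v w → c :* (p :+ q) :+ (v :+ w) := (c :* p :+ v) :+ (c :* q :+ w)) refl
    (χ zero) p q (dot (χ ∘ suc) v) (dot (χ ∘ suc) w)
  where open xor-∧-Solver

dot-e : (χ : Fin d → Bool) (i : Fin d) → dot χ (e i) ≡ χ i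
dot-e χ zero    rewrite dot-0ᵥ (χ ∘ suc) | ∧-identityʳ (χ zero) = xor-identityʳ (χ zero)
dot-e χ (suc i) rewrite ∧-zeroʳ (χ zero) = dot-e (χ ∘ suc) i

dot-xor : (χ ψ : Fin d → Bool) (v : 𝔽₂^ d) →
          dot (λ i → χ i xor ψ i) v ≡ dot χ v xor dot ψ v
dot-xor χ ψ []      = refl
dot-xor χ ψ (p ∷ v) rewrite dot-xor (χ ∘ suc) (ψ ∘ suc) v =
  solve 5 (λ c k p v w → (c :+ k) :* p :+ (v :+ w) := (c :* p :+ v) :+ (k :* p :+ w)) refl
    (χ zero) (ψ zero) p (dot (χ ∘ suc) v) (dot (ψ ∘ suc) v)
  where open xor-∧-Solver

dot-cong : (χ ψ : Fin d → Bool) (v : 𝔽₂^ d) →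
           (∀ i → lookup v i ≡ true → χ i ≡ ψ i) → dot χ v ≡ dot ψ v
dot-cong χ ψ []      eq = refl
dot-cong χ ψ (p ∷ v) eq = cong₂ _xor_ (head p (eq zero)) (dot-cong (χ ∘ suc) (ψ ∘ suc) v (eq ∘ suc))
  where
  head : ∀ p → (p ≡ true → χ zero ≡ ψ zero) → χ zero ∧ p ≡ ψ zero ∧ p
  head false _  = trans (∧-zeroʳ (χ zero)) (sym (∧-zeroʳ (ψ zero)))
  head true  eq = cong (_∧ true) (eq refl)

dot-false : (v : 𝔽₂^ d) → dot (const false) v ≡ false
dot-false []      = refl
dot-false (p ∷ v) = dot-false v

dot-lookup-e : (i : Fin d) (v : 𝔽₂^ d) → dot (lookup (e i)) v ≡ lookup v i
dot-lookup-e zero    (p ∷ v) = trans (cong (p xor_) zeros) (xor-identityʳ p)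
  where
  zeros : dot (lookup 0ᵥ) v ≡ false
  zeros = trans (dot-cong _ _ v (λ i _ → lookup-replicate i false)) (dot-false v)
dot-lookup-e (suc i) (p ∷ v) = dot-lookup-e i v

-- Spans

Span-least : {G : Pred (𝔽₂^ d) 0ℓ} (W : Subspace d) → G ⊆ ⟦ W ⟧ → Span G ⊆ ⟦ W ⟧
Span-least W G⊆W (gen v∈G) = G⊆W v∈G
Span-least W G⊆W zero      = Subspace.0-closed W
Span-least W G⊆W (add p q) = Subspace.+-closed W (Span-least W G⊆W p) (Span-least W G⊆W q)

-- As a subspace it fits `Span-least`, which reduces the equality of two functionals on a span to
-- the generators.
equalizer : (χ ψ : Fin d → Bool) → Subspace d
equalizer χ ψ = record
  { ⟦_⟧      = λ v → dot χ v ≡ dot ψ v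
  ; 0-closed = trans (dot-0ᵥ χ) (sym (dot-0ᵥ ψ))
  ; +-closed = λ {v} {w} p q →
      trans (dot-+ᵥ χ v w) (trans (cong₂ _xor_ p q) (sym (dot-+ᵥ ψ v w)))
  }

supportedOn : Pred (Fin d) 0ℓ → Subspace d
supportedOn {d} T = record
  { ⟦_⟧      = λ v → ∀ {i} → lookup v i ≡ true → i ∈ T
  ; 0-closed = λ {i} eq → contradiction (trans (sym eq) (lookup-replicate i false)) λ ()
  ; +-closed = λ {v} {w} p q {i} eq → closed v w p q i eq
  }
  where
  closed : (v w : 𝔽₂^ d) →
           (∀ {i} → lookup v i ≡ true → i ∈ T) → (∀ {i} → lookup w i ≡ true → i ∈ T) →
           ∀ i → lookup (v +ᵥ w) i ≡ true → i ∈ T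
  closed v w p q i eq with lookup v i in eqᵥ | trans (sym (lookup-+ᵥ v w i)) eq
  ... | true  | _   = p eqᵥ
  ... | false | eq′ = q eq′

-- Families spanned by pairwise disjoint sets of edges, each having an end (a
-- port) that lies on no other edge.

module Pendant {K Q : Set} {d : ℕ}
  (port : Q → Fin d) (portAt : Fin d → Maybe Q)
  (portAt-port : ∀ q → portAt (port q) ≡ just q)
  (port-portAt : ∀ {i q} → portAt i ≡ just q → port q ≡ i)
  -- The only edge at a port, given by its family index and its other end; `nothing` marks a port
  -- without an edge.
  (tie : Q → Maybe (K × Fin d))
  (portAt-tie : ∀ {q k a} → tie q ≡ just (k , a) → portAt a ≡ nothing)
  where

  Edges : K → Pred (𝔽₂^ d) 0ℓ
  Edges k v = ∃₂ λ q a → tie q ≡ just (k , a) × v ≡ e (port q) -ᵥ e a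

  W : K → Subspace d
  W k = span (Edges k)

  port-injective : ∀ {q q′} → port q ≡ port q′ → q ≡ q′
  port-injective {q} {q′} eq =
    just-injective (trans (sym (portAt-port q)) (trans (cong portAt eq) (portAt-port q′)))

  port≢tie : ∀ {q q′ k a} → tie q ≡ just (k , a) → port q′ ≢ a
  port≢tie {q′ = q′} t refl with trans (sym (portAt-port q′)) (portAt-tie t)
  ... | ()

  W-spanned : ∀ k → SpannedByEdgeVectors (W k)
  W-spanned k = Edges k , (λ (q , a , t , eq) → port q , a , port≢tie t , eq) , id , id

  -- The functional that sees only the port coordinates and agrees with χ on
  -- every edge.
  shadow : (Fin d → Bool) → Fin d → Bool
  shadow χ c = maybe (λ q → χ (port q) xor maybe (χ ∘ proj₂) false (tie q)) false (portAt c)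

  shadow-tied : ∀ χ {q k a} → tie q ≡ just (k , a) → shadow χ (port q) ≡ χ (port q) xor χ a
  shadow-tied χ {q} t rewrite portAt-port q | t = refl

  shadow-unported : ∀ χ {c} → portAt c ≡ nothing → shadow χ c ≡ false
  shadow-unported χ eq rewrite eq = refl

  module _ {I : Set} (κ : I → K) where

    edge∈⨆ : ∀ {q a} i → tie q ≡ just (κ i , a) → e (port q) +ᵥ e a ∈ ⟦ ⨆ (W ∘ κ) ⟧
    edge∈⨆ i t = gen (i , gen (_ , _ , t , refl))

    ⨆-least : (X : Subspace d) →
              (∀ {q a} i → tie q ≡ just (κ i , a) → e (port q) +ᵥ e a ∈ ⟦ X ⟧) →
              ⟦ ⨆ (W ∘ κ) ⟧ ⊆ ⟦ X ⟧
    ⨆-least X edges = Span-least X λ (i , p) →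
      Span-least X (λ { (q , a , t , refl) → edges i t }) p

    -- A port lies on its own edge only, so it can be lit only if that edge is a generator.
    support : ∀ {v q} → v ∈ ⟦ ⨆ (W ∘ κ) ⟧ → lookup v (port q) ≡ true →
              ∃₂ λ i a → tie q ≡ just (κ i , a)
    support {v} {q} v∈ lit = ⨆-least (supportedOn Tied) edge-tied v∈ lit q refl
      where
      -- Vacuous at coordinates that are not ports, so the other ends of edges are unconstrained.
      Tied : Pred (Fin d) 0ℓ
      Tied c = ∀ q → port q ≡ c → ∃₂ λ i a → tie q ≡ just (κ i , a)

      edge-tied : ∀ {q a} i → tie q ≡ just (κ i , a) → ∀ {c} →
                  lookup (e (port q) +ᵥ e a) c ≡ true → Tied c
      edge-tied {q} {a} i t lit q′ refl with port q′ ≟ port q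
      ... | yes eq rewrite port-injective eq = i , a , t
      ... | no neq with trans (sym lit) (trans (lookup-+ᵥ (e (port q)) (e a) (port q′))
                          (cong₂ _xor_ (lookup-e-≢ neq) (lookup-e-≢ (port≢tie t))))
      ...   | ()

    -- Generators suffice, and on an edge the shadow moves the whole value to the port. On the span,
    -- every functional can thus be read off the ports alone.
    dot-shadow : ∀ χ {v} → v ∈ ⟦ ⨆ (W ∘ κ) ⟧ → dot χ v ≡ dot (shadow χ) v
    dot-shadow χ = ⨆-least (equalizer χ (shadow χ)) edge
      where
      open ≡-Reasoning
      edge : ∀ {q a} i → tie q ≡ just (κ i , a) →
             dot χ (e (port q) +ᵥ e a) ≡ dot (shadow χ) (e (port q) +ᵥ e a)
      edge {q} {a} i t = begin
        dot χ (e (port q) +ᵥ e a)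
          ≡⟨ dot-+ᵥ χ (e (port q)) (e a) ⟩
        dot χ (e (port q)) xor dot χ (e a)
          ≡⟨ cong₂ _xor_ (dot-e χ (port q)) (dot-e χ a) ⟩
        χ (port q) xor χ a
          ≡⟨ shadow-tied χ t ⟨
        shadow χ (port q)
          ≡⟨ xor-identityʳ _ ⟨
        shadow χ (port q) xor false
          ≡⟨ cong₂ _xor_ (dot-e (shadow χ) (port q))
               (trans (dot-e (shadow χ) a) (shadow-unported χ (portAt-tie t))) ⟨
        dot (shadow χ) (e (port q)) xor dot (shadow χ) (e a)
          ≡⟨ dot-+ᵥ (shadow χ) (e (port q)) (e a) ⟨
        dot (shadow χ) (e (port q) +ᵥ e a) ∎

    -- Each coordinate is a functional, hence equals its shadow, which reads ports only.
    dark-ports⇒0ᵥ : ∀ {v} → v ∈ ⟦ ⨆ (W ∘ κ) ⟧ → (∀ q → lookup v (port q) ≡ false) → v ≡ 0ᵥ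
    dark-ports⇒0ᵥ {v} v∈ dark = lookup-false⇒0ᵥ v λ i → begin
      lookup v i                    ≡⟨ dot-lookup-e i v ⟨
      dot (lookup (e i)) v          ≡⟨ dot-shadow _ v∈ ⟩
      dot (shadow (lookup (e i))) v ≡⟨ dot-cong _ _ v (unseen (lookup (e i))) ⟩
      dot (const false) v           ≡⟨ dot-false v ⟩
      false                         ∎
      where
      open ≡-Reasoning
      unseen : ∀ χ c → lookup v c ≡ true → shadow χ c ≡ false
      unseen χ c lit with portAt c in eq
      ... | nothing = refl
      ... | just q with trans (sym lit) (trans (cong (lookup v) (sym (port-portAt eq))) (dark q))
      ...   | ()

  -- A lit port of a common vector would tie its unique edge to an index in both sets, so all ports
  -- are dark.
  W-disjoint : (S₁ S₂ : Pred K 0ℓ) → S₁ ⊥ S₂ →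
               ⟦ ⨆ {I = ∃ S₁} (W ∘ proj₁) ⟧ ∩ ⟦ ⨆ {I = ∃ S₂} (W ∘ proj₁) ⟧ ≐ ｛ 0ᵥ ｝
  W-disjoint S₁ S₂ S₁⊥S₂ =
    (λ (v∈₁ , v∈₂) → sym (dark-ports⇒0ᵥ proj₁ v∈₁ λ q → ¬-not (clash q v∈₁ v∈₂))) ,
    λ { refl → zero , zero }
    where
    clash : ∀ {v} q → v ∈ ⟦ ⨆ {I = ∃ S₁} (W ∘ proj₁) ⟧ → v ∈ ⟦ ⨆ {I = ∃ S₂} (W ∘ proj₁) ⟧ →
            lookup v (port q) ≢ true
    clash q v∈₁ v∈₂ lit with support proj₁ v∈₁ lit | support proj₁ v∈₂ lit
    ... | (k , k∈₁) , a , t | (k′ , k′∈₂) , a′ , t′ with just-injective (trans (sym t) t′)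
    ...   | refl = S₁⊥S₂ (k∈₁ , k′∈₂)

-- Coordinates: one per vertex u, four ports (u , b , c) per vertex, and one
-- unused block.

Port : ℕ → Set
Port s = Fin s × Bool × Bool

block : Bool × Bool → Fin 6
block (false , false) = 1F
block (false , true)  = 2F
block (true  , false) = 3F
block (true  , true)  = 4F

unblock : Fin 6 → Maybe (Bool × Bool)
unblock 0F = nothing
unblock 1F = just (false , false)
unblock 2F = just (false , true)
unblock 3F = just (true , false)
unblock 4F = just (true , true)
unblock 5F = nothing

unblock-block : ∀ bc → unblock (block bc) ≡ just bc
unblock-block (false , false) = refl
unblock-block (false , true)  = refl
unblock-block (true  , false) = refl
unblock-block (true  , true)  = refl

block-unblock : ∀ k {bc} → unblock k ≡ just bc → block bc ≡ k
block-unblock 1F refl = refl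
block-unblock 2F refl = refl
block-unblock 3F refl = refl
block-unblock 4F refl = refl
block-unblock 5F ()

-- Abstract, because unfolding remQuot {6} makes conversion checking very slow.
abstract
  vert : Fin s → Fin (6 * s)
  vert u = combine {6} 0F u

  port : Port s → Fin (6 * s)
  port (u , bc) = combine {6} (block bc) u

  -- The argument s is explicit since it cannot be recovered from 6 * s.
  vertexOf : ∀ s → Fin (6 * s) → Fin s
  vertexOf s c = proj₂ (remQuot {6} s c)

  portIn : Fin 6 × Fin s → Maybe (Port s)
  portIn (k , u) = map (u ,_) (unblock k)

  portAt : ∀ s → Fin (6 * s) → Maybe (Port s)
  portAt s c = portIn (remQuot {6} s c)

  vertexOf-vert : (u : Fin s) → vertexOf s (vert u) ≡ u
  vertexOf-vert u = cong proj₂ (remQuot-combine {6} 0F u)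

  portAt-vert : (u : Fin s) → portAt s (vert u) ≡ nothing
  portAt-vert u = cong portIn (remQuot-combine {6} 0F u)

  portAt-port : (q : Port s) → portAt s (port q) ≡ just q
  portAt-port (u , bc) =
    trans (cong portIn (remQuot-combine {6} (block bc) u))
          (cong (map (u ,_)) (unblock-block bc))

  port-portAt : ∀ {c} {q : Port s} → portAt s c ≡ just q → port q ≡ c
  port-portAt {s} {c} eq = trans (port-portIn (remQuot {6} s c) eq) (combine-remQuot {6} s c)
    where
    port-portIn : ∀ (ku : Fin 6 × Fin s) {q} → portIn ku ≡ just q →
                  port q ≡ combine (proj₁ ku) (proj₂ ku)
    port-portIn (k , u) eq with unblock k in eq′
    port-portIn (k , u) refl | just bc = cong (λ k → combine k u) (block-unblock k eq′)

-- Runs of a branching program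

module Runs {Var : Set} (P : BranchingProgram Var s) where
  open BranchingProgram P

  -- Acyclicity makes the transitive closure a strict partial order on a finite set, hence
  -- noetherian; single steps inherit this.
  ⟶-noetherian : WellFounded (flip _⟶_)
  ⟶-noetherian u = below (spo-noetherian isSPO u)
    where
    isSPO : IsStrictPartialOrder _≡_ (TransClosure _⟶_)
    isSPO = record
      { isEquivalence = isEquivalence
      ; irrefl        = λ { refl → acyclic _ }
      ; trans         = _++_
      ; <-resp-≈      = (λ { refl p → p }) , (λ { refl p → p })
      }
    below : ∀ {u} → Acc (flip (TransClosure _⟶_)) u → Acc (flip _⟶_) u
    below (acc rec) = acc λ u⟶w → below (rec [ u⟶w ])

  query-injective : ∀ {z z′ : Var} {next next′ : Bool → Fin s} →
                    query z next ≡ query z′ next′ → z ≡ z′ × next ≡ next′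
  query-injective refl = refl , refl

  sink≢query : ∀ {u z next} → node u ≡ sink → node u ≢ query z next
  sink≢query eq eq′ with trans (sym eq) eq′
  ... | ()

  accept-sink : node accept ≡ sink
  accept-sink = Equivalence.from (sink⇔ accept) (inj₁ refl)

  module _ (σ : Var → Bool) where

    _⇝_ : Fin s → Fin s → Set
    _⇝_ = Star (Closed σ)

    run-step : ∀ {u z next} → node u ≡ query z next → Closed σ u (next (σ z))
    run-step eq = _ , _ , (_ , eq , refl) , refl

    run-uncons : ∀ {u z next w} → node u ≡ query z next → u ≢ w → u ⇝ w → next (σ z) ⇝ w
    run-uncons eq u≢w ε = contradiction refl u≢w
    run-uncons eq u≢w ((_ , _ , (_ , eq′ , refl) , refl) ◅ run)
      with query-injective (trans (sym eq) eq′)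
    ... | refl , refl = run

    sink-run : ∀ {u w} → node u ≡ sink → u ⇝ w → u ≡ w
    sink-run eq ε = refl
    sink-run eq ((_ , _ , (_ , eq′ , _) , _) ◅ _) = contradiction eq′ (sink≢query eq)

    no-return : ∀ {u z next} → node u ≡ query z next → ¬ (next (σ z) ⇝ u)
    no-return {u} eq run = acyclic u (close (_ , _ , _ , eq , refl) run)
      where
      close : ∀ {u v w} → u ⟶ v → v ⇝ w → TransClosure _⟶_ u w
      close u⟶v ε = [ u⟶v ]
      close u⟶v ((z , b , edge , _) ◅ run) = u⟶v ∷ close (z , b , edge) run

    -- A query vertex has exactly one closed outgoing edge, so the search just follows the
    -- computation, which ends by acyclicity.
    _⇝?_ : ∀ u w → Dec (u ⇝ w)
    u ⇝? w = decide u (⟶-noetherian u)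
      where
      step : ∀ {u} N → node u ≡ N → u ≢ w → (∀ {v} → u ⟶ v → Dec (v ⇝ w)) → Dec (u ⇝ w)
      step sink           eq u≢w rec = no (u≢w ∘ sink-run eq)
      step (query z next) eq u≢w rec = map′ (run-step eq ◅_) (run-uncons eq u≢w)
        (rec (z , σ z , next , eq , refl))

      decide : ∀ u → Acc (flip _⟶_) u → Dec (u ⇝ w)
      decide u (acc rec) with u ≟ w
      ... | yes refl = yes ε
      ... | no u≢w   = step (node u) refl u≢w λ u⟶v → decide _ (rec u⟶v)

    reaches : Fin s → Fin s → Bool
    reaches w u = does (u ⇝? w)

    reaches-next : ∀ {u z next w} → node u ≡ query z next → u ≢ w →
                   reaches w u ≡ reaches w (next (σ z))
    reaches-next eq u≢w =
      does-⇔ (mk⇔ (run-uncons eq u≢w) (run-step eq ◅_)) (_ ⇝? _) (_ ⇝? _)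

    -- If the start does not run to accept, the run edges stay independent after
    -- identifying accept with start; detect u₀ is the member of the dual basis
    -- belonging to the edge out of u₀. Its second term makes the values at
    -- accept and start agree, while being constant along edges.
    detect : Fin s → Fin s → Bool
    detect u₀ w = reaches u₀ w xor (reaches u₀ start ∧ reaches accept w)

    -- As `u` is neither `u₀` nor `accept`, stepping to its successor changes neither reachability
    -- of `u₀` nor that of `accept`.
    detect-edge-≢ : ∀ {u₀ u z next} → node u ≡ query z next → u ≢ u₀ →
                    detect u₀ u xor detect u₀ (next (σ z)) ≡ false
    detect-edge-≢ {u₀} {u} {z} {next} eq u≢u₀
      rewrite reaches-next eq u≢u₀
            | reaches-next {w = accept} eq (λ { refl → sink≢query accept-sink eq })
      = xor-same (detect u₀ (next (σ z)))

    -- By acyclicity the successor no longer reaches `u`, while the second term of `detect` is the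
    -- same at both ends and cancels.
    detect-edge : ∀ {u z next} → node u ≡ query z next →
                  detect u u xor detect u (next (σ z)) ≡ true
    detect-edge {u} {z} {next} eq
      rewrite reaches-next {w = accept} eq (λ { refl → sink≢query accept-sink eq })
            | dec-true (u ⇝? u) ε
            | dec-false (next (σ z) ⇝? u) (no-return eq)
      = begin
      (true xor c) xor c ≡⟨ solve 1 (λ c → (con true :+ c) :+ c := con true) refl c ⟩
      true               ∎
      where
      open ≡-Reasoning
      open xor-∧-Solver
      c = reaches u start ∧ reaches accept (next (σ z))

    -- Both sides equal `reaches u start`: at `start` the second term vanishes by rejection, and at
    -- `accept` the first one does because a sink reaches no query vertex.
    detect-accept : ∀ {u z next} → node u ≡ query z next → ¬ Accepts σ →
                    detect u accept ≡ detect u start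
    detect-accept {u} eq rejects
      rewrite dec-false (start ⇝? accept) rejects
            | dec-true (accept ⇝? accept) ε
            | dec-false (accept ⇝? u)
                (λ run → sink≢query accept-sink (trans (cong node (sink-run accept-sink run)) eq))
            | ∧-zeroʳ (reaches u start) | ∧-identityʳ (reaches u start)
            | xor-identityʳ (reaches u start) = refl

-- The decomposition obtained from a branching program

module Construction (P : BranchingProgram (Fin n ⊎ Fin n) s) (o : Fin n) where
  open BranchingProgram P
  open Runs P

  glue : Fin s → Fin s
  glue u = if does (u ≟ accept) then start else u

  glue-accept : glue accept ≡ start
  glue-accept rewrite dec-true (accept ≟ accept) refl = refl

  glue-start : glue start ≡ start
  glue-start rewrite dec-false (start ≟ accept) start≢accept = refl

  glue-invariant : (h : Fin s → Bool) → h accept ≡ h start → ∀ u → h (glue u) ≡ h u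
  glue-invariant h eq u with u ≟ accept
  ... | yes refl = sym eq
  ... | no _     = refl

  Tie : Set
  Tie = Maybe ((Fin n × Bool) × Fin (6 * s))

  leftTie rightTie : Node (Fin n ⊎ Fin n) s → Port s → Tie
  leftTie sink                  _           = nothing
  leftTie (query (inj₁ i) next) (u , b , c) = just ((i , b) , vert (glue u))
  leftTie (query (inj₂ j) next) (u , b , c) = just ((o , c) , vert (glue (next b)))
  rightTie sink                  _           = nothing
  rightTie (query (inj₁ i) next) (u , b , c) = just ((o , c) , vert (glue (next b)))
  rightTie (query (inj₂ j) next) (u , b , c) = just ((j , b) , vert (glue u))

  portAt-leftTie : ∀ N q {k a} → leftTie N q ≡ just (k , a) → portAt s a ≡ nothing
  portAt-leftTie (query (inj₁ i) next) (u , b , c) refl = portAt-vert (glue u)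
  portAt-leftTie (query (inj₂ j) next) (u , b , c) refl = portAt-vert (glue (next b))

  portAt-rightTie : ∀ N q {k a} → rightTie N q ≡ just (k , a) → portAt s a ≡ nothing
  portAt-rightTie (query (inj₁ i) next) (u , b , c) refl = portAt-vert (glue (next b))
  portAt-rightTie (query (inj₂ j) next) (u , b , c) refl = portAt-vert (glue u)

  tieU tieV : Port s → Tie
  tieU q = leftTie  (node (proj₁ q)) q
  tieV q = rightTie (node (proj₁ q)) q

  module U = Pendant port (portAt s) portAt-port port-portAt tieU
    (λ {q} → portAt-leftTie (node (proj₁ q)) q)
  module V = Pendant port (portAt s) portAt-port port-portAt tieV
    (λ {q} → portAt-rightTie (node (proj₁ q)) q)

  module _ (x y : Vec Bool n) where

    σ : Fin n ⊎ Fin n → Bool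
    σ = [ lookup x , lookup y ]′

    -- Selects which of the two parallel paths is present: bit `o` of the input that the label does
    -- not belong to.
    copy : Fin n ⊎ Fin n → Bool
    copy = [ const (lookup y o) , const (lookup x o) ]′

    ιx ιy : Fin n → Fin n × Bool
    ιx i = i , lookup x i
    ιy j = j , lookup y j

    -- Two orientations occur, since the side owning the label holds the half at the tail `u`.
    Ends : Fin s → Fin s → Fin (6 * s) → Fin (6 * s) → Set
    Ends u w a a′ = (a ≡ vert (glue u) × a′ ≡ vert (glue w))
                  ⊎ (a ≡ vert (glue w) × a′ ≡ vert (glue u))

    active-tied : ∀ {u next} z → node u ≡ query z next →
      ∃₂ λ i a → ∃₂ λ j a′ → tieU (u , σ z , copy z) ≡ just (ιx i , a)
                            × tieV (u , σ z , copy z) ≡ just (ιy j , a′)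
                            × Ends u (next (σ z)) a a′
    active-tied (inj₁ i) eq rewrite eq = i , _ , o , _ , refl , refl , inj₁ (refl , refl)
    active-tied (inj₂ j) eq rewrite eq = o , _ , j , _ , refl , refl , inj₂ (refl , refl)

    -- Presence on one side fixes the edge bit of the port and presence on the other its copy bit;
    -- together they single out a followed edge.
    tied-active : ∀ {u bc i j a a′} →
      tieU (u , bc) ≡ just (ιx i , a) → tieV (u , bc) ≡ just (ιy j , a′) →
      ∃₂ λ z next → node u ≡ query z next × bc ≡ (σ z , copy z) × Ends u (next (σ z)) a a′
    tied-active {u} t t′ with node u in eq
    tied-active refl refl | query (inj₁ i) next = inj₁ i , next , refl , refl , inj₁ (refl , refl)
    tied-active refl refl | query (inj₂ j) next = inj₂ j , next , refl , refl , inj₂ (refl , refl)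

    lit-active : ∀ {v} → v ∈ ⟦ φ U.W x ⟧ → v ∈ ⟦ φ V.W y ⟧ →
      ∀ {u bc} → lookup v (port (u , bc)) ≡ true →
      ∃₂ λ a a′ →
      (∃[ k ] tieU (u , bc) ≡ just (k , a)) × (∃[ k ] tieV (u , bc) ≡ just (k , a′)) ×
      (∃₂ λ z next → node u ≡ query z next × bc ≡ (σ z , copy z) × Ends u (next (σ z)) a a′)
    lit-active v∈U v∈V lit with U.support ιx v∈U lit | V.support ιy v∈V lit
    ... | i , a , t | j , a′ , t′ = a , a′ , (_ , t) , (_ , t′) , tied-active t t′

    -- If a common vector lit `q₀`, the functional `h` lifted from `detect` would have shadows for
    -- `U` and `V` that differ, on the support of `v`, exactly at `q₀`. Both shadows compute
    -- `dot h v`, which would then differ from itself by one.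
    rejects⇒trivial : ¬ Accepts σ → ∀ {v} → v ∈ ⟦ φ U.W x ⟧ → v ∈ ⟦ φ V.W y ⟧ → v ≡ 0ᵥ
    rejects⇒trivial rejects {v} v∈U v∈V = U.dark-ports⇒0ᵥ ιx v∈U λ q → ¬-not (dark q)
      where
      dark : ∀ q → lookup v (port q) ≢ true
      dark q₀@(u₀ , bc₀) lit₀ with lit-active v∈U v∈V lit₀
      ... | _ , _ , _ , _ , z₀ , next₀ , eq₀ , bc₀≡ , _ = x≢x-xor-true (dot h v) (begin
        dot h v
          ≡⟨ U.dot-shadow ιx h v∈U ⟩
        dot (U.shadow h) v
          ≡⟨ dot-cong _ _ v (λ c lit → agree c lit (portAt s c) refl) ⟩
        dot (λ c → V.shadow h c xor lookup (e (port q₀)) c) v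
          ≡⟨ dot-xor (V.shadow h) _ v ⟩
        dot (V.shadow h) v xor dot (lookup (e (port q₀))) v
          ≡⟨ cong₂ _xor_ (sym (V.dot-shadow ιy h v∈V)) (trans (dot-lookup-e (port q₀) v) lit₀) ⟩
        dot h v xor true ∎)
        where
        open ≡-Reasoning

        x≢x-xor-true : ∀ b → b ≢ b xor true
        x≢x-xor-true false ()
        x≢x-xor-true true  ()

        -- The values at ports are immaterial, as they cancel between the two shadows.
        h : Fin (6 * s) → Bool
        h c = detect σ u₀ (vertexOf s c)

        h-vert : ∀ u → h (vert (glue u)) ≡ detect σ u₀ u
        h-vert u = trans (cong (detect σ u₀) (vertexOf-vert (glue u)))
                         (glue-invariant (detect σ u₀) (detect-accept σ eq₀ rejects) u)

        h-ends : ∀ {u w a a′} → Ends u w a a′ → h a xor h a′ ≡ detect σ u₀ u xor detect σ u₀ w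
        h-ends {u} {w} (inj₁ (refl , refl)) = cong₂ _xor_ (h-vert u) (h-vert w)
        h-ends {u} {w} (inj₂ (refl , refl)) =
          trans (cong₂ _xor_ (h-vert w) (h-vert u)) (xor-comm (detect σ u₀ w) (detect σ u₀ u))

        dual : ∀ {u bc z next} → node u ≡ query z next → bc ≡ (σ z , copy z) →
               detect σ u₀ u xor detect σ u₀ (next (σ z)) ≡ lookup (e (port q₀)) (port (u , bc))
        dual {u} eq bc≡ with u ≟ u₀
        ... | no u≢u₀ = trans (detect-edge-≢ σ eq u≢u₀)
                (sym (lookup-e-≢ λ p → u≢u₀ (cong proj₁ (U.port-injective p))))
        -- The label of `u₀` determines both bits, so `q₀` is the only active port there.
        ... | yes refl with query-injective (trans (sym eq₀) eq)
        ...   | refl , refl rewrite trans bc≡ (sym bc₀≡) =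
                trans (detect-edge σ eq) (sym (lookup-e (port q₀)))

        agree : ∀ c → lookup v c ≡ true → ∀ m → portAt s c ≡ m →
                U.shadow h c ≡ V.shadow h c xor lookup (e (port q₀)) c
        agree c lit nothing  eq = begin
          U.shadow h c        ≡⟨ U.shadow-unported h eq ⟩
          false               ≡⟨ cong₂ _xor_ (V.shadow-unported h eq) (lookup-e-≢ c≢q₀) ⟨
          V.shadow h c xor lookup (e (port q₀)) c ∎
          where
          c≢q₀ : c ≢ port q₀
          c≢q₀ refl with trans (sym eq) (portAt-port q₀)
          ... | ()
        agree c lit (just q@(u , bc)) eq with port-portAt {c = c} eq
        ... | refl with lit-active v∈U v∈V lit
        ...   | a , a′ , (_ , t) , (_ , t′) , z , next , equ , bc≡ , ends = begin
          U.shadow h (port q)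
            ≡⟨ U.shadow-tied h t ⟩
          h (port q) xor h a
            ≡⟨ solve 3 (λ p a a′ → p :+ a := (p :+ a′) :+ (a :+ a′)) refl (h (port q)) (h a) (h a′) ⟩
          (h (port q) xor h a′) xor (h a xor h a′)
            ≡⟨ cong₂ _xor_ (sym (V.shadow-tied h t′)) (trans (h-ends ends) (dual equ bc≡)) ⟩
          V.shadow h (port q) xor lookup (e (port q₀)) (port q) ∎
          where open xor-∧-Solver

    -- The sums of the U-edges and of the V-edges along a run from w to accept.
    record Trail (w : Fin s) : Set where
      field
        {v₁ v₂} : 𝔽₂^ (6 * s)
        v₁∈     : v₁ ∈ ⟦ φ U.W x ⟧
        v₂∈     : v₂ ∈ ⟦ φ V.W y ⟧
        sum     : v₁ +ᵥ v₂ ≡ e (vert (glue w)) +ᵥ e (vert start)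
        unseen  : ∀ q → ¬ (_⇝_ σ w (proj₁ q)) → lookup v₁ (port q) ≡ false
        nonzero : w ≢ accept → v₁ ≢ 0ᵥ

    -- The run never returns to `w`, so the port of the first edge is dark in the rest of the trail
    -- and stays lit in the sum; `unseen` carries this through the induction.
    trail : ∀ {w} → _⇝_ σ w accept → Trail w
    trail ε = record
      { v₁∈     = zero
      ; v₂∈     = zero
      ; sum     = trans (+ᵥ-same 0ᵥ) (trans (sym (+ᵥ-same (e (vert start))))
                    (cong (λ u → e (vert u) +ᵥ e (vert start)) (sym glue-accept)))
      ; unseen  = λ q _ → lookup-replicate (port q) false
      ; nonzero = λ w≢w → contradiction refl w≢w
      }
    trail {w} ((z , _ , (next , eq , refl) , refl) ◅ run)
      with active-tied z eq | trail run
    ... | i , a , j , a′ , t , t′ , ends | rest = record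
      { v₁∈     = add (U.edge∈⨆ ιx i t) R.v₁∈
      ; v₂∈     = add (V.edge∈⨆ ιy j t′) R.v₂∈
      ; sum     = sum ends
      ; unseen  = λ q ¬run → v₁-lookup (port q) false
          (lookup-e-≢ λ p → ¬run (subst (_⇝_ σ w) (sym (cong proj₁ (U.port-injective p))) ε))
          (U.port≢tie t) (R.unseen q (¬run ∘ (run-step σ eq ◅_)))
      ; nonzero = λ _ v₁≡0 → contradiction
          (trans (sym (v₁-lookup (port p) true (lookup-e (port p)) (U.port≢tie t)
                        (R.unseen p (no-return σ eq))))
                 (trans (cong (λ v → lookup v (port p)) v₁≡0) (lookup-replicate (port p) false)))
          λ ()
      }
      where
      module R = Trail rest
      p = w , σ z , copy z

      v₁-lookup : ∀ c b → lookup (e (port p)) c ≡ b → c ≢ a → lookup R.v₁ c ≡ false →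
                  lookup (e (port p) +ᵥ e a +ᵥ R.v₁) c ≡ b
      v₁-lookup c b eqb c≢a eq₀
        rewrite lookup-+ᵥ (e (port p) +ᵥ e a) R.v₁ c | lookup-+ᵥ (e (port p)) (e a) c
              | eqb | lookup-e-≢ c≢a | eq₀ | xor-identityʳ b | xor-identityʳ b = refl

      sum : Ends w (next (σ z)) a a′ →
            (e (port p) +ᵥ e a +ᵥ R.v₁) +ᵥ (e (port p) +ᵥ e a′ +ᵥ R.v₂) ≡
            e (vert (glue w)) +ᵥ e (vert start)
      sum (inj₁ (refl , refl)) = +ᵥ-telescope _ _ _ _ R.v₁ R.v₂ R.sum
      -- Here the `V`-half is the one at the tail, so the two sums exchange roles.
      sum (inj₂ (refl , refl)) = trans (+ᵥ-comm (e (port p) +ᵥ e a +ᵥ R.v₁) _)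
        (+ᵥ-telescope _ _ _ _ R.v₂ R.v₁ (trans (+ᵥ-comm R.v₂ R.v₁) R.sum))

    -- At `start` the trail closes up, because `accept` is glued to `start`; its two sums then
    -- coincide and give the common vector.
    accepts⇔nontrivial : Accepts σ ⇔ (∃[ v ] ((v ∈ ⟦ φ U.W x ⟧ × v ∈ ⟦ φ V.W y ⟧) × v ≢ 0ᵥ))
    accepts⇔nontrivial = mk⇔ to from
      where
      to : Accepts σ → _
      to run = T.v₁ , (T.v₁∈ , subst (_∈ ⟦ φ V.W y ⟧) (sym v₁≡v₂) T.v₂∈) , T.nonzero start≢accept
        where
        module T = Trail (trail run)
        v₁≡v₂ : T.v₁ ≡ T.v₂
        v₁≡v₂ = +ᵥ-cancel T.v₁ T.v₂ (e (vert start))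
          (trans T.sum (cong (λ u → e (vert u) +ᵥ e (vert start)) glue-start))

      from : _ → Accepts σ
      from (v , (v∈U , v∈V) , v≢0) with _⇝?_ σ start accept
      ... | yes run    = run
      ... | no rejects = contradiction (rejects⇒trivial rejects v∈U v∈V) v≢0

-- The start vertex is no sink, so it reads a bit; the position of that bit supplies the index `o`.
some-variable : BranchingProgram (Fin n ⊎ Fin n) s → Fin n
some-variable P = variable-of (node start) refl
  where
  open BranchingProgram P
  variable-of : ∀ N → node start ≡ N → Fin _
  variable-of (query z _) _  = reduce z
  variable-of sink        eq with Equivalence.to (sink⇔ start) eq
  ... | inj₁ start≡accept = contradiction start≡accept start≢accept
  ... | inj₂ start≡reject = contradiction start≡reject start≢reject

lemma5p3 : (n s : ℕ) (f : Vec Bool n → Vec Bool n → Bool)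
    (P : BranchingProgram (Fin n ⊎ Fin n) s) →
    Computes P f → bitpdim f ≤ (6 * s)
lemma5p3 n s f P computes = record
  { U          = U.W
  ; V          = V.W
  ; represents = λ x y → accepts⇔nontrivial x y ⇔-∘ ⇔-sym (computes x y)
  ; U-spanned  = U.W-spanned
  ; V-spanned  = V.W-spanned
  ; U-disjoint = U.W-disjoint
  ; V-disjoint = V.W-disjoint
  }
  where open Construction P (some-variable P)
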